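{- Let $G$ be a closed group with $\operatorname{GL}(\omega,2)\lneqq G\leq\operatorname{Sym}(\mathbb{F}_2^\omega)_0$. Then $G=\operatorname{Sym}(\mathbb{F}_2^\omega)_0$.
   Context: $\mathbb{F}_2^\omega$ denotes the countably infinite dimensional vector space over the two element field, $\operatorname{GL}(\omega,2)$ its automorphism group, $\operatorname{Sym}(\mathbb{F}_2^\omega)$ the group of all permutations of its elements, and $\operatorname{Sym}(\mathbb{F}_2^\omega)_0$ the stabilizer of the zero vector in $\operatorname{Sym}(\mathbb{F}_2^\omega)$. A subgroup $H\le \operatorname{Sym}(\Omega)$ is closed if it is closed in the topology of pointwise convergence: whenever $\pi\in\operatorname{Sym}(\Omega)$ is such that for every finite $S\subset\Omega$ there is $\sigma_S\in H$ with $\sigma_S|_S=\pi|_S$, then $\pi\in H$. -}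

module Defs where

open import Algebra.Bundles using (CommutativeRing; Group)
open import Algebra.Module.Bundles using (Module)
open import Algebra.Module.Morphism.Structures using (module ModuleMorphisms)
open import Data.Bool.Base using (Bool; false; _∧_; _xor_)
open import Data.Bool.Properties using (xor-∧-commutativeRing; ∧-zeroʳ)
open import Data.List.Base using (List)
open import Data.List.Relation.Unary.All using (All)
open import Data.Nat.Base using (ℕ; _≤_; _⊔_)
open import Data.Nat.Properties using (m⊔n≤o⇒m≤o; m⊔n≤o⇒n≤o)
open import Data.Product.Base using (Σ-syntax; _×_; _,_; proj₁; proj₂)
open import Function.Base using (id; _∘_)
open import Function.Bundles using (Inverse)
import Function.Construct.Composition as Composition
import Function.Construct.Identity as Identity
import Function.Construct.Symmetry as Symmetry
open import Level using (Level; 0ℓ) renaming (_⊔_ to _⊔ˡ_)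
open import Relation.Binary.Bundles using (Setoid)
open import Relation.Binary.Definitions using (_Respects_)
open import Relation.Binary.PropositionalEquality using (_≡_; refl; sym; trans; cong₂)
open import Relation.Unary using (Pred)

private
  variable
    a ℓ p : Level

------------------------------------------------------------------------
-- Permutation groups

-- (σ ∙ τ)(x) = σ(τ(x)), and permutations are compared pointwise.
Sym : Setoid a ℓ → Group (a ⊔ˡ ℓ) (a ⊔ˡ ℓ)
Sym Ω = record
  { Carrier = Inverse Ω Ω
  ; _≈_     = λ σ τ → ∀ x → to σ x ≈ to τ x
  ; _∙_     = λ σ τ → Composition.inverse τ σ
  ; ε       = Identity.inverse Ω
  ; _⁻¹     = Symmetry.inverse
  ; isGroup = record
    { isMonoid = record
      { isSemigroup = record
        { isMagma = record
          { isEquivalence = record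
            { refl  = λ _ → S.refl
            ; sym   = λ p x → S.sym (p x)
            ; trans = λ p q x → S.trans (p x) (q x)
            }
          ; ∙-cong = λ {σ} {_} {_} {τ′} p q x →
              S.trans (to-cong σ (q x)) (p (to τ′ x))
          }
        ; assoc = λ _ _ _ _ → S.refl
        }
      ; identity = (λ _ _ → S.refl) , (λ _ _ → S.refl)
      }
    ; inverse = (λ σ → strictlyInverseʳ σ) , (λ σ → strictlyInverseˡ σ)
    ; ⁻¹-cong = λ {σ} {τ} p x →
        S.trans (from-cong σ
                  (S.trans (S.sym (strictlyInverseˡ τ x))
                           (S.sym (p (from τ x)))))
                (strictlyInverseʳ σ (from τ x))
    }
  }
  where
  module S = Setoid Ω
  open Setoid Ω using (_≈_)
  open Inverse

record IsSubgroup {c ℓ p} (𝔾 : Group c ℓ) (H : Pred (Group.Carrier 𝔾) p)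
                  : Set (c ⊔ˡ ℓ ⊔ˡ p) where
  open Group 𝔾
  field
    resp      : H Respects _≈_
    ε-closed  : H ε
    ∙-closed  : ∀ {x y} → H x → H y → H (x ∙ y)
    ⁻¹-closed : ∀ {x} → H x → H (x ⁻¹)

module _ (Ω : Setoid a ℓ) where
  open Setoid Ω using (_≈_) renaming (Carrier to X)
  open Group (Sym Ω) using () renaming (Carrier to Perm)
  open Inverse using (to)

  -- Closed in Sym Ω for pointwise convergence; a finite subset of Ω is
  -- given by a list enumerating it.
  IsClosed : Pred Perm p → Set (a ⊔ˡ ℓ ⊔ˡ p)
  IsClosed H = ∀ (π : Perm) →
    (∀ (S : List X) → Σ[ σ ∈ Perm ] (H σ × All (λ x → to σ x ≈ to π x) S)) →
    H π

  Stabilizer : X → Pred Perm ℓ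
  Stabilizer x σ = to σ x ≈ x

------------------------------------------------------------------------
-- The space of finitely supported sequences over 𝔽₂

𝔽₂ : CommutativeRing 0ℓ 0ℓ
𝔽₂ = xor-∧-commutativeRing

-- The bound need not be sharp; it is ignored by the equality of the
-- module below.
record FinSupp : Set where
  field
    coeff     : ℕ → Bool
    bound     : ℕ
    vanishing : ∀ i → bound ≤ i → coeff i ≡ false

open FinSupp

𝔽₂^ω : Module 𝔽₂ 0ℓ 0ℓ
𝔽₂^ω = record
  { Carrierᴹ = FinSupp
  ; _≈ᴹ_ = λ u v → ∀ i → coeff u i ≡ coeff v i
  ; _+ᴹ_ = λ u v → record
    { coeff     = λ i → coeff u i xor coeff v i
    ; bound     = bound u ⊔ bound v
    ; vanishing = λ i b≤i → cong₂ _xor_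
        (vanishing u i (m⊔n≤o⇒m≤o (bound u) (bound v) b≤i))
        (vanishing v i (m⊔n≤o⇒n≤o (bound u) (bound v) b≤i))
    }
  ; _*ₗ_ = scale
  ; _*ᵣ_ = λ v c → scale c v
  ; 0ᴹ   = record { coeff = λ _ → false ; bound = 0 ; vanishing = λ _ _ → refl }
  ; -ᴹ_  = id
  ; isModule = record
    { isBimodule = record
      { isBisemimodule = record
        { +ᴹ-isCommutativeMonoid = record
          { isMonoid = record
            { isSemigroup = record
              { isMagma = record
                { isEquivalence = record
                  { refl  = λ _ → refl
                  ; sym   = λ p i → sym (p i)
                  ; trans = λ p q i → trans (p i) (q i)
                  }
                ; ∙-cong = λ p q i → cong₂ _xor_ (p i) (q i)
                }
              ; assoc = λ u v w i → F.+-assoc (coeff u i) (coeff v i) (coeff w i)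
              }
            ; identity = (λ v i → F.+-identityˡ (coeff v i))
                       , (λ v i → F.+-identityʳ (coeff v i))
            }
          ; comm = λ u v i → F.+-comm (coeff u i) (coeff v i)
          }
        ; isPreleftSemimodule = record
          { *ₗ-cong      = λ p q i → cong₂ _∧_ p (q i)
          ; *ₗ-zeroˡ     = λ v i → F.zeroˡ (coeff v i)
          ; *ₗ-distribʳ  = λ v c d i → F.distribʳ (coeff v i) c d
          ; *ₗ-identityˡ = λ v i → F.*-identityˡ (coeff v i)
          ; *ₗ-assoc     = λ c d v i → F.*-assoc c d (coeff v i)
          ; *ₗ-zeroʳ     = λ c i → F.zeroʳ c
          ; *ₗ-distribˡ  = λ c u v i → F.distribˡ c (coeff u i) (coeff v i)
          }
        ; isPrerightSemimodule = record
          { *ᵣ-cong      = λ q p i → cong₂ _∧_ p (q i)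
          ; *ᵣ-zeroʳ     = λ v i → F.zeroˡ (coeff v i)
          ; *ᵣ-distribˡ  = λ v c d i → F.distribʳ (coeff v i) c d
          ; *ᵣ-identityʳ = λ v i → F.*-identityˡ (coeff v i)
          ; *ᵣ-assoc     = λ v c d i →
              trans (sym (F.*-assoc d c (coeff v i)))
                    (F.*-congʳ (F.*-comm d c))
          ; *ᵣ-zeroˡ     = λ c i → F.zeroʳ c
          ; *ᵣ-distribʳ  = λ c u v i → F.distribˡ c (coeff u i) (coeff v i)
          }
        ; *ₗ-*ᵣ-assoc = λ c v d i →
            trans (sym (F.*-assoc d c (coeff v i)))
                  (trans (F.*-congʳ (F.*-comm d c)) (F.*-assoc c d (coeff v i)))
        }
      ; -ᴹ‿cong    = id
      ; -ᴹ‿inverse = (λ v i → F.-‿inverseˡ (coeff v i))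
                   , (λ v i → F.-‿inverseʳ (coeff v i))
      }
    ; *ₗ-*ᵣ-coincident = λ _ _ _ → refl
    }
  }
  where
  module F = CommutativeRing 𝔽₂

  scale : Bool → FinSupp → FinSupp
  scale c v = record
    { coeff     = λ i → c ∧ coeff v i
    ; bound     = bound v
    ; vanishing = λ i b≤i → trans (cong₂ _∧_ refl (vanishing v i b≤i)) (∧-zeroʳ c)
    }

open Module 𝔽₂^ω using (0ᴹ; rawModule) renaming (≈ᴹ-setoid to V) public

Sym[𝔽₂^ω] : Group 0ℓ 0ℓ
Sym[𝔽₂^ω] = Sym V

GL[ω,2] : Pred (Group.Carrier Sym[𝔽₂^ω]) 0ℓ
GL[ω,2] σ = IsModuleIsomorphism (Inverse.to σ)
  where open ModuleMorphisms rawModule rawModule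

Sym[𝔽₂^ω]₀ : Pred (Group.Carrier Sym[𝔽₂^ω]) 0ℓ
Sym[𝔽₂^ω]₀ = Stabilizer V 0ᴹ

{-# OPTIONS --safe #-}
module Submission where

-- It suffices that G is k-transitive on the nonzero vectors for every k: an
-- element of Sym₀ then agrees with elements of G on every finite set. By
-- induction, let G be k-transitive. Any k + 1 distinct nonzero vectors can be
-- brought to (e₀ , … , eₖ₋₁ , y), and some element of G must fix e₀ , … , eₖ₋₁
-- and send y to eₖ.
--   * If y ∉ Span(e₀ , … , eₖ₋₁), a transvection does this.
--   * If y is the sum of a proper subset omitting eᵢ, then k-transitivity makes the
--     k vectors y , eⱼ (j ≠ i) a part of the basis, and eᵢ is moved to general position.
--   * If y = e₀ + … + eₖ₋₁, it is enough to find an element of G that fixes all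
--     eⱼ and moves y. For k = 2 a nonlinear element of G provides it; for k ≥ 3 a
--     linear one conjugated by a map from e₀ , … , eₖ₋₁ onto k vectors with sum 0.

open import Defs
open import Algebra.Bundles using (CommutativeRing; Group)
open import Algebra.Module.Bundles using (Module)
import Algebra.Properties.CommutativeSemigroup as CommutativeSemigroupProperties
open import Axiom.ExcludedMiddle using (ExcludedMiddle)
open import Data.Bool.Base using (Bool; true; false; _∧_; _xor_)
open import Data.Bool.Properties
  using (¬-not; xor-comm; xor-identityʳ; xor-same)
  renaming (_≟_ to _≟ᵇ_)
open import Data.List.Base using (List; []; _∷_)
open import Data.List.Relation.Unary.All using (All; []; _∷_)
import Data.List.Relation.Unary.All as All
open import Data.Nat.Base using (ℕ; zero; suc; _≤_; _<_; _⊔_; z≤n; s≤s; z<s)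
open import Data.Nat.Properties
open import Data.Product.Base using (Σ-syntax; ∃-syntax; _×_; _,_)
open import Data.Sum.Base using (_⊎_; inj₁; inj₂)
open import Function.Base using (_∘_)
open import Function.Bundles using (Inverse)
open import Relation.Binary.Bundles using (Setoid)
open import Relation.Binary.PropositionalEquality
  using (_≡_; _≢_; refl; sym; trans; cong; cong₂)
import Relation.Binary.Reasoning.Setoid as SetoidReasoning
open import Relation.Nullary using (¬_; Dec; yes; no; does; contradiction)
open import Relation.Nullary.Decidable using (dec-true; dec-false; _×-dec_)
open import Relation.Unary using (Pred; _⊆_; _⊂_; _≐_)

open FinSupp
open Group Sym[𝔽₂^ω] using (_∙_; ε; _⁻¹) renaming (Carrier to Perm)
open Inverse using (to; from)
open Module 𝔽₂^ω using (_+ᴹ_; _*ₗ_)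

private
  module F = CommutativeRing 𝔽₂
  variable
    i j k l m n : ℕ
    u v w x y z : FinSupp

-- Pointwise equality and addition of vectors.

-- A record type, unlike the equality of the module, determines its sides, so
-- that they can be left implicit.
infix 4 _≋_
record _≋_ (u v : FinSupp) : Set where
  constructor pointwise
  field at : ∀ i → coeff u i ≡ coeff v i

open _≋_

≋-setoid : Setoid _ _
≋-setoid = record
  { Carrier       = FinSupp
  ; _≈_           = _≋_
  ; isEquivalence = record
    { refl  = pointwise λ _ → refl
    ; sym   = λ p → pointwise (sym ∘ at p)
    ; trans = λ p q → pointwise λ i → trans (at p i) (at q i)
    }
  }

open Setoid ≋-setoid using ()
  renaming (refl to ≋-refl; sym to ≋-sym; trans to ≋-trans; reflexive to ≋-reflexive)
module ≋-Reasoning = SetoidReasoning ≋-setoid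

true≢false : true ≢ false
true≢false ()

differ-at : ∀ i → coeff u i ≡ true → coeff v i ≡ false → ¬ u ≋ v
differ-at i p q u≋v = true≢false (trans (sym p) (trans (at u≋v i) q))

+ᴹ-cong : u ≋ v → x ≋ y → u +ᴹ x ≋ v +ᴹ y
+ᴹ-cong p q = pointwise λ i → cong₂ _xor_ (at p i) (at q i)

+ᴹ-self : ∀ x → x +ᴹ x ≋ 0ᴹ
+ᴹ-self x = pointwise λ i → xor-same (coeff x i)

x+[x+y]≋y : ∀ x y → x +ᴹ (x +ᴹ y) ≋ y
x+[x+y]≋y x y = pointwise λ i → xor-cancelˡ (coeff x i) (coeff y i)
  where
  xor-cancelˡ : ∀ a b → a xor (a xor b) ≡ b
  xor-cancelˡ true  true  = refl
  xor-cancelˡ true  false = refl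
  xor-cancelˡ false _     = refl

y+[x+y]≋x : ∀ x y → y +ᴹ (x +ᴹ y) ≋ x
y+[x+y]≋x x y = pointwise λ i →
  trans (cong (coeff y i xor_) (xor-comm (coeff x i) (coeff y i)))
        (at (x+[x+y]≋y y x) i)

[x+y]+y≋x : ∀ x y → (x +ᴹ y) +ᴹ y ≋ x
[x+y]+y≋x x y = pointwise λ i →
  trans (xor-comm (coeff x i xor coeff y i) (coeff y i)) (at (y+[x+y]≋x x y) i)

+ᴹ-identityʳ : ∀ x → x +ᴹ 0ᴹ ≋ x
+ᴹ-identityʳ x = pointwise λ i → xor-identityʳ (coeff x i)

-- Permutations and linearity.

to-cong : ∀ (g : Perm) → x ≋ y → to g x ≋ to g y
to-cong {x} {y} g p = pointwise (Inverse.to-cong g {x} {y} (at p))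

to-from : ∀ (g : Perm) x → to g (from g x) ≋ x
to-from g x = pointwise (Inverse.strictlyInverseˡ g x)

from-to : ∀ (g : Perm) x → from g (to g x) ≋ x
from-to g x = pointwise (Inverse.strictlyInverseʳ g x)

to⇒from : ∀ (g : Perm) → to g x ≋ y → from g y ≋ x
to⇒from {x} g p = ≋-trans (to-cong (g ⁻¹) (≋-sym p)) (from-to g x)

to-injective : ∀ (g : Perm) → to g x ≋ to g y → x ≋ y
to-injective {x} {y} g p = ≋-trans (≋-sym (to⇒from g p)) (from-to g y)

Additive : Perm → Set
Additive g = ∀ x y → to g (x +ᴹ y) ≋ to g x +ᴹ to g y

additive-0 : ∀ (g : Perm) → Additive g → to g 0ᴹ ≋ 0ᴹ
additive-0 g add = begin
  to g 0ᴹ               ≈⟨ to-cong g (+ᴹ-self 0ᴹ) ⟨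
  to g (0ᴹ +ᴹ 0ᴹ)       ≈⟨ add 0ᴹ 0ᴹ ⟩
  to g 0ᴹ +ᴹ to g 0ᴹ    ≈⟨ +ᴹ-self (to g 0ᴹ) ⟩
  0ᴹ                    ∎
  where open ≋-Reasoning

-- The only scalars are 0 and 1, so compatibility with scalars follows from additivity.
additive⇒GL : ∀ (g : Perm) → Additive g → GL[ω,2] g
additive⇒GL g add = record
  { isModuleMonomorphism = record
    { isModuleHomomorphism = record
      { isBimoduleHomomorphism = record
        { +ᴹ-isGroupHomomorphism = record
          { isMonoidHomomorphism = record
            { isMagmaHomomorphism = record
              { isRelHomomorphism = record
                { cong = λ {x} {y} → Inverse.to-cong g {x} {y} }
              ; homo = λ x y → at (add x y)
              }
            ; ε-homo = at (additive-0 g add)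
            }
          ; ⁻¹-homo = λ _ _ → refl
          }
        ; *ₗ-homo = λ c x → at (scale-homo c x)
        ; *ᵣ-homo = λ c x → at (scale-homo c x)
        }
      }
    ; injective = λ p → at (to-injective g (pointwise p))
    }
  ; surjective = λ y → from g y , λ {z} p →
      at (≋-trans (to-cong g (pointwise {z} {from g y} p)) (to-from g y))
  }
  where
  scale-homo : ∀ c x → to g (c *ₗ x) ≋ c *ₗ to g x
  scale-homo true  x = ≋-trans (to-cong g (pointwise λ _ → refl)) (pointwise λ _ → refl)
  scale-homo false x =
    ≋-trans (to-cong g (pointwise λ _ → refl))
            (≋-trans (additive-0 g add) (pointwise λ _ → refl))

-- Linear functionals and transvections.

record Functional : Set where
  field
    ⟦_⟧     : FinSupp → Bool
    ⟦⟧-cong : x ≋ y → ⟦_⟧ x ≡ ⟦_⟧ y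
    ⟦⟧-homo : ∀ x y → ⟦_⟧ (x +ᴹ y) ≡ ⟦_⟧ x xor ⟦_⟧ y

open Functional

xor-interchange : ∀ a b c d → (a xor b) xor (c xor d) ≡ (a xor c) xor (b xor d)
xor-interchange = CommutativeSemigroupProperties.interchange F.+-commutativeSemigroup

coord : ℕ → Functional
coord i = record
  { ⟦_⟧     = λ x → coeff x i
  ; ⟦⟧-cong = λ p → at p i
  ; ⟦⟧-homo = λ _ _ → refl
  }

infixl 6 _⊕_
_⊕_ : Functional → Functional → Functional
φ ⊕ ψ = record
  { ⟦_⟧     = λ x → ⟦ φ ⟧ x xor ⟦ ψ ⟧ x
  ; ⟦⟧-cong = λ p → cong₂ _xor_ (⟦⟧-cong φ p) (⟦⟧-cong ψ p)
  ; ⟦⟧-homo = λ x y →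
      trans (cong₂ _xor_ (⟦⟧-homo φ x y) (⟦⟧-homo ψ x y))
            (xor-interchange (⟦ φ ⟧ x) (⟦ φ ⟧ y) (⟦ ψ ⟧ x) (⟦ ψ ⟧ y))
  }

-- The transvection z ↦ z + φ(z)(x + y), which exchanges x and y.
module Transvection (φ : Functional) (x y : FinSupp)
                    (φx : ⟦ φ ⟧ x ≡ true) (φy : ⟦ φ ⟧ y ≡ true) where

  T : FinSupp → FinSupp
  T z = z +ᴹ (⟦ φ ⟧ z *ₗ (x +ᴹ y))

  T-fixes : ⟦ φ ⟧ z ≡ false → T z ≋ z
  T-fixes {z} φz rewrite φz = pointwise λ i → xor-identityʳ (coeff z i)

  T-moves : ⟦ φ ⟧ z ≡ true → T z ≋ z +ᴹ (x +ᴹ y)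
  T-moves φz rewrite φz = pointwise λ _ → refl

  T-cong : u ≋ v → T u ≋ T v
  T-cong u≋v = pointwise λ i →
    cong₂ _xor_ (at u≋v i) (cong (_∧ coeff (x +ᴹ y) i) (⟦⟧-cong φ u≋v))

  -- Since φ(x + y) = 1 + 1 = 0, φ takes the same value at z and `T z`, so the second application
  -- adds the same vector again.
  T-involutive : ∀ z → T (T z) ≋ z
  T-involutive z = by-value (⟦ φ ⟧ z) refl
    where
    by-value : ∀ b → ⟦ φ ⟧ z ≡ b → T (T z) ≋ z
    by-value false φz = ≋-trans (T-cong (T-fixes φz)) (T-fixes φz)
    by-value true  φz =
      ≋-trans (T-cong (T-moves φz)) (≋-trans (T-moves φ[z+x+y]) ([x+y]+y≋x z (x +ᴹ y)))
      where
      φ[z+x+y] : ⟦ φ ⟧ (z +ᴹ (x +ᴹ y)) ≡ true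
      φ[z+x+y] rewrite ⟦⟧-homo φ z (x +ᴹ y) | ⟦⟧-homo φ x y | φx | φy | φz = refl

  T-homo : ∀ u v → T (u +ᴹ v) ≋ T u +ᴹ T v
  T-homo u v = pointwise λ i → let t = coeff (x +ᴹ y) i in
    trans (cong ((coeff u i xor coeff v i) xor_)
            (trans (cong (_∧ t) (⟦⟧-homo φ u v)) (F.distribʳ t (⟦ φ ⟧ u) (⟦ φ ⟧ v))))
          (xor-interchange (coeff u i) (coeff v i) (⟦ φ ⟧ u ∧ t) (⟦ φ ⟧ v ∧ t))

  perm : Perm
  perm = record
    { to        = T
    ; from      = T
    ; to-cong   = λ p → at (T-cong (pointwise p))
    ; from-cong = λ p → at (T-cong (pointwise p))
    ; inverse   = (λ p → at (≋-trans (T-cong (pointwise p)) (T-involutive _)))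
                , (λ p → at (≋-trans (T-cong (pointwise p)) (T-involutive _)))
    }

  T-x : T x ≋ y
  T-x = ≋-trans (T-moves φx) (x+[x+y]≋y x y)

  T-y : T y ≋ x
  T-y = ≋-trans (T-moves φy) (y+[x+y]≋x x y)

-- Basis vectors, their sums and supports.

e : ℕ → FinSupp
e k = record
  { coeff     = λ i → does (i ≟ k)
  ; bound     = suc k
  ; vanishing = λ i k<i → dec-false (i ≟ k) (>⇒≢ k<i)
  }

e-diag : ∀ k → coeff (e k) k ≡ true
e-diag k = dec-true (k ≟ k) refl

e-off : i ≢ k → coeff (e k) i ≡ false
e-off {i} {k} = dec-false (i ≟ k)

e-injective : e i ≋ e j → i ≡ j
e-injective {i} {j} p with i ≟ j
... | yes i≡j = i≡j
... | no  i≢j = contradiction p (differ-at i (e-diag i) (e-off i≢j))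

e≉0 : ¬ e k ≋ 0ᴹ
e≉0 {k} = differ-at k (e-diag k) refl

-- Written as the indicator of the indices below `k` rather than as an iterated sum, so that its
-- coefficients are read off directly.
∑e : ℕ → FinSupp
∑e k = record
  { coeff     = λ i → does (i <? k)
  ; bound     = k
  ; vanishing = λ i k≤i → dec-false (i <? k) (≤⇒≯ k≤i)
  }

∑e-inside : i < k → coeff (∑e k) i ≡ true
∑e-inside {i} {k} = dec-true (i <? k)

∑e-outside : k ≤ i → coeff (∑e k) i ≡ false
∑e-outside = vanishing (∑e _) _

∑e≉0 : 1 ≤ k → ¬ ∑e k ≋ 0ᴹ
∑e≉0 1≤k = differ-at 0 (∑e-inside 1≤k) refl

∑e≉e : 2 ≤ k → ¬ ∑e k ≋ e j
∑e≉e {j = zero}  2≤k = differ-at 1 (∑e-inside 2≤k) refl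
∑e≉e {j = suc j} 2≤k = differ-at 0 (∑e-inside (<⇒≤ 2≤k)) refl

-- Membership in Span(e₀ , ... , eₖ₋₁).
Supported : ℕ → FinSupp → Set
Supported k x = ∀ m → k ≤ m → coeff x m ≡ false

-- Only the finitely many coefficients below `bound x` have to be searched.
supported? : ∀ k x → Supported k x ⊎ (∃[ m ] k ≤ m × coeff x m ≡ true)
supported? k x
  with anyUpTo? (λ m → (k ≤? m) ×-dec (coeff x m ≟ᵇ true)) (bound x)
... | yes (m , _ , k≤m , xₘ) = inj₂ (m , k≤m , xₘ)
... | no  ¬∃ = inj₁ λ m k≤m → ¬-not λ xₘ →
  ¬∃ (m , ≰⇒> (λ b≤m → true≢false (trans (sym xₘ) (vanishing x m b≤m))) , k≤m , xₘ)

supported-0 : Supported 0 x → x ≋ 0ᴹ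
supported-0 s = pointwise λ i → s i z≤n

nonzero-coeff : ¬ x ≋ 0ᴹ → ∃[ m ] coeff x m ≡ true
nonzero-coeff {x} x≉0 with supported? 0 x
... | inj₁ s             = contradiction (supported-0 s) x≉0
... | inj₂ (m , _ , xₘ) = m , xₘ

+≋0⇒≋ : x +ᴹ y ≋ 0ᴹ → x ≋ y
+≋0⇒≋ {x} {y} p = begin
  x              ≈⟨ [x+y]+y≋x x y ⟨
  (x +ᴹ y) +ᴹ y  ≈⟨ +ᴹ-cong p (≋-refl {y}) ⟩
  0ᴹ +ᴹ y        ≈⟨ pointwise (λ _ → refl) ⟩
  y              ∎
  where open ≋-Reasoning

-- In characteristic 2, x = y exactly when x + y = 0, and a nonzero coefficient of x + y can be
-- searched for.
_≋?_ : ∀ x y → Dec (x ≋ y)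
x ≋? y with supported? 0 (x +ᴹ y)
... | inj₁ s              = yes (+≋0⇒≋ (supported-0 s))
... | inj₂ (m , _ , x+yₘ) = no λ x≋y →
  differ-at m x+yₘ refl (≋-trans (+ᴹ-cong x≋y (≋-refl {y})) (+ᴹ-self y))

full⇒∑e : Supported k x → (∀ {i} → i < k → coeff x i ≡ true) → x ≋ ∑e k
full⇒∑e {k} {x} s full = pointwise eq
  where
  eq : ∀ i → coeff x i ≡ coeff (∑e k) i
  eq i with i <? k
  ... | yes i<k = trans (full i<k) (sym (∑e-inside i<k))
  ... | no  i≮k = trans (s i (≮⇒≥ i≮k)) (sym (∑e-outside (≮⇒≥ i≮k)))

∑e-or-gap : ∀ k x → Supported k x → x ≋ ∑e k ⊎ (∃[ i ] i < k × coeff x i ≡ false)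
∑e-or-gap k x s with anyUpTo? (λ i → coeff x i ≟ᵇ false) k
... | yes gap = inj₂ gap
... | no  ¬∃  = inj₁ (full⇒∑e s λ i<k → ¬-not λ xᵢ → ¬∃ (_ , i<k , xᵢ))

-- Linear maps exchanging two vectors.

record Exchange (i m : ℕ) (w : FinSupp) : Set where
  constructor exchanging
  field
    perm     : Perm
    additive : Additive perm
    eᵢ↦w     : to perm (e i) ≋ w
    w↦eᵢ     : to perm w ≋ e i
    fixes    : ∀ {y} → coeff y i ≡ false → coeff y m ≡ false → to perm y ≋ y

-- The transvection needs a functional with value 1 at both `e i` and `w`: coordinate `i` if `w` is
-- nonzero there, otherwise the sum of coordinates `i` and `m`. Either one vanishes on vectors that
-- are zero at `i` and `m`.
exchange : ∀ i w m → coeff w m ≡ true → Exchange i m w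
exchange i w m wₘ = by-value (coeff w i) refl
  where
  by-value : ∀ b → coeff w i ≡ b → Exchange i m w
  by-value true  wᵢ = exchanging perm T-homo T-x T-y λ yᵢ _ → T-fixes yᵢ
    where open Transvection (coord i) (e i) w (e-diag i) wᵢ
  by-value false wᵢ = exchanging perm T-homo T-x T-y λ yᵢ yₘ → T-fixes (cong₂ _xor_ yᵢ yₘ)
    where
    m≢i : m ≢ i
    m≢i refl = true≢false (trans (sym wₘ) wᵢ)
    open Transvection (coord i ⊕ coord m) (e i) w
           (cong₂ _xor_ (e-diag i) (e-off m≢i)) (cong₂ _xor_ wᵢ wₘ)

-- The transposition of coordinates `i` and `j`.
record Swap (i j : ℕ) : Set where
  constructor swapping
  field
    perm     : Perm
    additive : Additive perm
    eᵢ↦eⱼ    : to perm (e i) ≋ e j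
    eⱼ↦eᵢ    : to perm (e j) ≋ e i
    fixes    : ∀ {y} → coeff y i ≡ coeff y j → to perm y ≋ y
    moves    : ∀ {y} → coeff y i ≡ false → coeff y j ≡ true → ¬ to perm y ≋ y

swap : ∀ i j → i ≢ j → Swap i j
swap i j i≢j = swapping perm T-homo T-x T-y fixes moves
  where
  open Transvection (coord i ⊕ coord j) (e i) (e j)
         (cong₂ _xor_ (e-diag i) (e-off (i≢j ∘ sym)))
         (cong₂ _xor_ (e-off i≢j) (e-diag j))
  fixes : ∀ {y} → coeff y i ≡ coeff y j → T y ≋ y
  fixes {y} yᵢ≡yⱼ = T-fixes (trans (cong (_xor coeff y j) yᵢ≡yⱼ) (xor-same (coeff y j)))
  moves : ∀ {y} → coeff y i ≡ false → coeff y j ≡ true → ¬ T y ≋ y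
  moves {y} yᵢ yⱼ p = differ-at i
    (cong₂ _xor_ yᵢ (cong₂ _xor_ (e-diag i) (e-off i≢j))) yᵢ
    (≋-trans (≋-sym (T-moves {y} (cong₂ _xor_ yᵢ yⱼ))) p)

record LinearNormalizer (a b : FinSupp) : Set where
  constructor linear-normalizer
  field
    perm     : Perm
    additive : Additive perm
    a↦e₀     : to perm a ≋ e 0
    b↦e₁     : to perm b ≋ e 1

-- First `a` is exchanged with e₀. If the image of `b` has a nonzero coordinate past 0, it can be
-- exchanged with e₁ without disturbing e₀; otherwise it is 0 or e₀, against injectivity.
linear-two-transitive : ∀ {a b} → ¬ a ≋ 0ᴹ → ¬ b ≋ 0ᴹ → ¬ a ≋ b → LinearNormalizer a b
linear-two-transitive {a} {b} a≉0 b≉0 a≉b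
  with m , aₘ ← nonzero-coeff a≉0
  with exchanging h h-add _ ha _ ← exchange 0 a m aₘ
  with supported? 1 (to h b)
... | inj₂ (n , 1≤n , hbₙ)
  with exchanging h′ h′-add _ h′hb h′-fix ← exchange 1 (to h b) n hbₙ
  = linear-normalizer (h′ ∙ h)
      (λ x y → ≋-trans (to-cong h′ (h-add x y)) (h′-add _ _))
      (≋-trans (to-cong h′ ha) (h′-fix refl (e-off (>⇒≢ 1≤n))))
      h′hb
... | inj₁ s with coeff (to h b) 0 in hb₀
... | true  = contradiction (to-injective h (≋-trans ha (≋-sym hb≋e0))) a≉b
  where
  hb≋e0 : to h b ≋ e 0
  hb≋e0 = pointwise λ { zero → hb₀ ; (suc i) → s (suc i) (s≤s z≤n) }
... | false = contradiction (to-injective h (≋-trans hb≋0 (≋-sym (additive-0 h h-add)))) b≉0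
  where
  hb≋0 : to h b ≋ 0ᴹ
  hb≋0 = pointwise λ { zero → hb₀ ; (suc i) → s (suc i) (s≤s z≤n) }

-- Preimages outside a finite-dimensional subspace.

-- Span(e₀ , … , eₖ₋₁) is finite, so its image lies in some Span(e₀ , … , e_{B-1}).
image-bound : ∀ k (f : FinSupp → FinSupp) → (∀ {x y} → x ≋ y → f x ≋ f y) →
  ∃[ B ] (∀ {x} → Supported k x → Supported B (f x))
image-bound zero f f-cong = bound (f 0ᴹ) , λ s m b≤m →
  trans (at (f-cong (supported-0 s)) m) (vanishing (f 0ᴹ) m b≤m)
image-bound (suc k) f f-cong
  with B₀ , p₀ ← image-bound k f f-cong
  -- Span(e₀ , ... , eₖ) is the union of Span(e₀ , ... , eₖ₋₁) and its translate by eₖ.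
  with B₁ , p₁ ← image-bound k (f ∘ (_+ᴹ e k)) (λ p → f-cong (+ᴹ-cong p (≋-refl {e k})))
  = B₀ ⊔ B₁ , p
  where
  p : ∀ {x} → Supported (suc k) x → Supported (B₀ ⊔ B₁) (f x)
  p {x} s m B≤m with coeff x k in xₖ
  ... | false = p₀ s′ m (m⊔n≤o⇒m≤o B₀ B₁ B≤m)
    where
    s′ : Supported k x
    s′ i k≤i with m≤n⇒m<n∨m≡n k≤i
    ... | inj₁ k<i  = s i k<i
    ... | inj₂ refl = xₖ
  ... | true  =
    trans (sym (at (f-cong ([x+y]+y≋x x (e k))) m)) (p₁ {x +ᴹ e k} s′ m (m⊔n≤o⇒n≤o B₀ B₁ B≤m))
    where
    s′ : Supported k (x +ᴹ e k)
    s′ i k≤i with m≤n⇒m<n∨m≡n k≤i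
    ... | inj₁ k<i  = cong₂ _xor_ (s i k<i) (e-off (>⇒≢ k<i))
    ... | inj₂ refl = cong₂ _xor_ xₖ (e-diag k)

record FarPreimage (k : ℕ) (g : Perm) : Set where
  constructor far-preimage-at
  field
    N   : ℕ
    k≤N : k ≤ N
    M   : ℕ
    k≤M : k ≤ M
    M∈  : coeff (from g (e N)) M ≡ true

-- If `N` is past the bound for the image of Span(e₀ , ... , eₖ₋₁), then `e N` is not in that image,
-- so its preimage has a nonzero coordinate `M` at or beyond `k`.
far-preimage : ∀ k g → FarPreimage k g
far-preimage k g = by-bound (image-bound k (to g) (to-cong g))
  where
  by-bound : ∃[ B ] (∀ {x} → Supported k x → Supported B (to g x)) → FarPreimage k g
  by-bound (B , image) = by-support (supported? k (from g (e (B ⊔ k))))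
    where
    N : ℕ
    N = B ⊔ k
    by-support : Supported k (from g (e N)) ⊎ (∃[ m ] k ≤ m × coeff (from g (e N)) m ≡ true) →
      FarPreimage k g
    by-support (inj₁ s) = contradiction (≋-sym (to-from g (e N)))
      (differ-at N (e-diag N) (image s N (m≤m⊔n B k)))
    by-support (inj₂ (m , k≤m , wₘ)) = far-preimage-at N (m≤n⊔m B k) m k≤m wₘ

-- Finite families of distinct nonzero vectors.

update : (ℕ → FinSupp) → ℕ → FinSupp → ℕ → FinSupp
update a i y j with j ≟ i
... | yes _ = y
... | no  _ = a j

update-at : ∀ a i y → update a i y i ≡ y
update-at a i y with i ≟ i
... | yes _   = refl
... | no  i≢i = contradiction refl i≢i

update-off : ∀ a {i y j} → j ≢ i → update a i y j ≡ a j
update-off a {i} {y} {j} j≢i with j ≟ i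
... | yes j≡i = contradiction j≡i j≢i
... | no  _   = refl

-- Families are total functions on ℕ of which only the first `k` entries matter.
record Distinct (k : ℕ) (a : ℕ → FinSupp) : Set where
  field
    nonzero   : j < k → ¬ a j ≋ 0ᴹ
    injective : i < k → j < k → a i ≋ a j → i ≡ j

open Distinct

-- Nothing is asked of the old entry at `i`, so the same statement covers replacing an entry and
-- appending one.
update-distinct : ∀ {a} →
  (∀ {j} → j < k → j ≢ i → ¬ a j ≋ 0ᴹ) →
  (∀ {j l} → j < k → l < k → j ≢ i → l ≢ i → a j ≋ a l → j ≡ l) →
  ¬ y ≋ 0ᴹ → (∀ {j} → j < k → j ≢ i → ¬ a j ≋ y) →
  Distinct k (update a i y)
update-distinct {k} {i} {y} {a} nz inj y≉0 a≉y = record { nonzero = nz′ ; injective = inj′ }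
  where
  nz′ : j < k → ¬ update a i y j ≋ 0ᴹ
  nz′ {j} j<k with j ≟ i
  ... | yes _   = y≉0
  ... | no  j≢i = nz j<k j≢i
  inj′ : j < k → l < k → update a i y j ≋ update a i y l → j ≡ l
  inj′ {j} {l} j<k l<k p with j ≟ i | l ≟ i
  ... | yes j≡i | yes l≡i = trans j≡i (sym l≡i)
  ... | yes _   | no  l≢i = contradiction (≋-sym p) (a≉y l<k l≢i)
  ... | no  j≢i | yes _   = contradiction p (a≉y j<k j≢i)
  ... | no  j≢i | no  l≢i = inj j<k l<k j≢i l≢i p

update-e-distinct : ¬ y ≋ 0ᴹ → (∀ {j} → j < k → j ≢ i → ¬ e j ≋ y) →
  Distinct k (update e i y)
update-e-distinct = update-distinct (λ _ _ → e≉0) (λ _ _ _ _ → e-injective)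

perm-distinct : ∀ {a} (g : Perm) → to g 0ᴹ ≋ 0ᴹ → Distinct k a → Distinct k (to g ∘ a)
perm-distinct g g0 d = record
  { nonzero   = λ j<k p → nonzero d j<k (to-injective g (≋-trans p (≋-sym g0)))
  ; injective = λ i<k j<k p → injective d i<k j<k (to-injective g p)
  }

-- A finite list may contain 0 and repetitions; these are separated off because transitivity
-- concerns distinct nonzero vectors.
record Enumeration (S : List FinSupp) : Set where
  constructor enumeration
  field
    {size}   : ℕ
    {vector} : ℕ → FinSupp
    distinct : Distinct size vector
    covers   : All (λ x → x ≋ 0ᴹ ⊎ (∃[ j ] j < size × x ≋ vector j)) S

enumerate : ∀ (S : List FinSupp) → Enumeration S
enumerate [] = enumeration {size = 0} {e} record { nonzero = λ () ; injective = λ () } []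
enumerate (x ∷ S) with enumeration {k} {a} d cover ← enumerate S
  with x ≋? 0ᴹ | anyUpTo? (λ j → x ≋? a j) k
... | yes x≋0 | _       = enumeration d (inj₁ x≋0 ∷ cover)
... | no  _   | yes x∈a = enumeration d (inj₂ x∈a ∷ cover)
... | no  x≉0 | no  x∉a = enumeration
  (update-distinct (λ j<1+k j≢k → nonzero d (below j<1+k j≢k))
    (λ j< l< j≢ l≢ → injective d (below j< j≢) (below l< l≢))
    x≉0 (λ j<1+k j≢k p → x∉a (_ , below j<1+k j≢k , ≋-sym p)))
  (inj₂ (k , ≤-refl , ≋-reflexive (sym (update-at a k x))) ∷ All.map widen cover)
  where
  below : j < suc k → j ≢ k → j < k
  below j<1+k j≢k = ≤∧≢⇒< (m<1+n⇒m≤n j<1+k) j≢k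
  widen : y ≋ 0ᴹ ⊎ (∃[ j ] j < k × y ≋ a j) →
          y ≋ 0ᴹ ⊎ (∃[ j ] j < suc k × y ≋ update a k x j)
  widen (inj₁ y≋0)             = inj₁ y≋0
  widen (inj₂ (j , j<k , y≋aⱼ)) = inj₂
    (j , m<n⇒m<1+n j<k , ≋-trans y≋aⱼ (≋-reflexive (sym (update-off a (<⇒≢ j<k)))))

-- Extending partial normalizations inside an overgroup of the linear group.

Fixes : Perm → ℕ → Set
Fixes g k = ∀ {j} → j < k → to g (e j) ≋ e j

module Overgroup {ℓ} (G : Pred Perm ℓ) (G-subgroup : IsSubgroup Sym[𝔽₂^ω] G)
                 (GL⊆G : GL[ω,2] ⊆ G) (G⊆Sym₀ : G ⊆ Sym[𝔽₂^ω]₀) where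

  open IsSubgroup G-subgroup

  linear : ∀ g → Additive g → G g
  linear g add = GL⊆G (additive⇒GL g add)

  g0≋0 : ∀ g → G g → to g 0ᴹ ≋ 0ᴹ
  g0≋0 g Gg = pointwise (G⊆Sym₀ Gg)

  g≉0 : ∀ g → G g → ¬ x ≋ 0ᴹ → ¬ to g x ≋ 0ᴹ
  g≉0 g Gg x≉0 p = x≉0 (to-injective g (≋-trans p (≋-sym (g0≋0 g Gg))))

  record Normalizer (k : ℕ) (a : ℕ → FinSupp) : Set ℓ where
    constructor normalizer
    field
      perm : Perm
      ∈G   : G perm
      a↦e  : ∀ {j} → j < k → to perm (a j) ≋ e j

  -- One fixed target tuple suffices: a map between two arbitrary tuples is one normalizer followed
  -- by the inverse of another.
  Transitive : ℕ → Set ℓ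
  Transitive k = ∀ a → Distinct k a → Normalizer k a

  -- The passage from `k` to `k + 1` once the first `k` vectors have been normalized.
  record Extendable (k : ℕ) (y : FinSupp) : Set ℓ where
    constructor extension
    field
      perm  : Perm
      ∈G    : G perm
      fixes : Fixes perm k
      y↦eₖ  : to perm y ≋ e k

  -- Allows `y` to be replaced by any vector of its orbit under the pointwise stabilizer of e₀ , ...
  -- , eₖ₋₁ in `G`.
  transport : ∀ q → G q → Fixes q k → to q y ≋ z → Extendable k z → Extendable k y
  transport q Gq q-fix qy (extension g Gg g-fix gz) =
    extension (g ∙ q) (∙-closed {g} {q} Gg Gq)
      (λ j<k → ≋-trans (to-cong g (q-fix j<k)) (g-fix j<k))
      (≋-trans (to-cong g qy) gz)

  extend-outside : k ≤ m → coeff y m ≡ true → Extendable k y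
  extend-outside {k} {m} {y} k≤m yₘ with exchanging h h-add _ hy h-fix ← exchange k y m yₘ =
    extension h (linear h h-add)
      (λ j<k → h-fix (e-off (>⇒≢ j<k)) (e-off (>⇒≢ (<-≤-trans j<k k≤m))))
      hy

  -- G maps (eⱼ , y)_{j≠i} onto (eⱼ , eᵢ)_{j≠i}; eᵢ may first be moved to any w
  -- outside Span(e₀ , … , eₖ₋₁), and w is chosen so that its image is a far
  -- basis vector e_N.
  extend-inside : Transitive k → i < k → coeff y i ≡ false → Supported k y →
    ¬ y ≋ 0ᴹ → (∀ {j} → j < k → ¬ e j ≋ y) → Extendable k y
  extend-inside {k} {i} {y} trans-k i<k yᵢ y-supp y≉0 y≉e =
    by-normalizer (trans-k (update e i y) (update-e-distinct y≉0 (λ j<k _ → y≉e j<k)))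
    where
    by-normalizer : Normalizer k (update e i y) → Extendable k y
    by-normalizer (normalizer g Gg g-eq) = by-preimage (far-preimage k g)
      where
      g-eⱼ : j < k → j ≢ i → to g (e j) ≋ e j
      g-eⱼ j<k j≢i =
        ≋-trans (to-cong g (≋-reflexive (sym (update-off e j≢i)))) (g-eq j<k)

      g-y : to g y ≋ e i
      g-y = ≋-trans (to-cong g (≋-reflexive (sym (update-at e i y)))) (g-eq i<k)

      by-preimage : FarPreimage k g → Extendable k y
      by-preimage (far-preimage-at N k≤N m k≤m wₘ) =
        by-moves (exchange i (from g (e N)) m wₘ) (swap i N (<⇒≢ (<-≤-trans i<k k≤N)))
        where
        by-moves : Exchange i m (from g (e N)) → Swap i N → Extendable k y
        by-moves (exchanging h h-add h-eᵢ _ h-fix) (swapping σ σ-add σ-eᵢ σ-e_N σ-fix _) =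
          -- `h` fixes `y` and sends eᵢ to the preimage of e_N. After `g`, the vectors eᵢ and `y`
          -- have become e_N and eᵢ; `σ` swaps these, so eᵢ is restored and `y` ends at e_N, outside
          -- the span.
          transport (σ ∙ (g ∙ h))
            (∙-closed {σ} {g ∙ h} (linear σ σ-add) (∙-closed {g} {h} Gg (linear h h-add)))
            q-fix q-y (extend-outside k≤N (e-diag N))
          where
          open ≋-Reasoning

          q-y : to σ (to g (to h y)) ≋ e N
          q-y = begin
            to σ (to g (to h y))  ≈⟨ to-cong σ (to-cong g (h-fix yᵢ (y-supp m k≤m))) ⟩
            to σ (to g y)         ≈⟨ to-cong σ g-y ⟩
            to σ (e i)            ≈⟨ σ-eᵢ ⟩
            e N                   ∎

          q-fix : j < k → to σ (to g (to h (e j))) ≋ e j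
          q-fix {j} j<k with j ≟ i
          ... | yes refl = begin
            to σ (to g (to h (e i)))      ≈⟨ to-cong σ (to-cong g h-eᵢ) ⟩
            to σ (to g (from g (e N)))    ≈⟨ to-cong σ (to-from g (e N)) ⟩
            to σ (e N)                    ≈⟨ σ-e_N ⟩
            e i                           ∎
          ... | no j≢i = begin
            to σ (to g (to h (e j)))  ≈⟨ to-cong σ (to-cong g (h-fix (e-off (j≢i ∘ sym))
                                           (e-off (>⇒≢ (<-≤-trans j<k k≤m))))) ⟩
            to σ (to g (e j))         ≈⟨ to-cong σ (g-eⱼ j<k j≢i) ⟩
            to σ (e j)                ≈⟨ σ-fix (trans (e-off (j≢i ∘ sym))
                                           (sym (e-off (>⇒≢ (<-≤-trans j<k k≤N))))) ⟩
            e j                       ∎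

  extend-≉∑e : Transitive k → ¬ y ≋ 0ᴹ → (∀ {j} → j < k → ¬ e j ≋ y) →
    ¬ y ≋ ∑e k → Extendable k y
  extend-≉∑e {k} {y} trans-k y≉0 y≉e y≉∑ with supported? k y
  ... | inj₂ (m , k≤m , yₘ) = extend-outside k≤m yₘ
  ... | inj₁ s with ∑e-or-gap k y s
  ...   | inj₁ y≋∑             = contradiction y≋∑ y≉∑
  ...   | inj₂ (i , i<k , yᵢ) = extend-inside trans-k i<k yᵢ s y≉0 y≉e

  -- The sum of all the normalized basis vectors.

  extend-moved-∑e : ∀ q → 2 ≤ k → Transitive k → G q → Fixes q k →
    ¬ to q (∑e k) ≋ ∑e k → Extendable k (∑e k)
  extend-moved-∑e q 2≤k trans-k Gq q-fix moved =
    -- By injectivity the image of the sum is neither 0 nor one of the fixed eⱼ, and it is no longer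
    -- the sum, so the earlier cases apply to it.
    transport q Gq q-fix ≋-refl (extend-≉∑e trans-k
      (g≉0 q Gq (∑e≉0 (<⇒≤ 2≤k)))
      (λ j<k p → ∑e≉e 2≤k (≋-sym (to-injective q (≋-trans (q-fix j<k) p))))
      moved)

  -- If additivity failed at distinct nonzero `a`, `b`, linear maps normalizing (a , b) and (f a , f
  -- b) would turn `f` into an element of `G` fixing e₀ and e₁ but moving e₀ + e₁.
  additive-if-not-extendable : ∀ f → G f → Transitive 2 → ¬ Extendable 2 (∑e 2) →
    Additive f
  additive-if-not-extendable f Gf trans₂ ¬ext = additive
    where
    f0 = g0≋0 f Gf

    generic : ∀ a b → ¬ a ≋ 0ᴹ → ¬ b ≋ 0ᴹ → ¬ a ≋ b →
      ¬ to f (a +ᴹ b) ≋ to f a +ᴹ to f b → Extendable 2 (∑e 2)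
    generic a b a≉0 b≉0 a≉b f-moves =
      conjugate (linear-two-transitive a≉0 b≉0 a≉b)
        (linear-two-transitive (g≉0 f Gf a≉0) (g≉0 f Gf b≉0) (a≉b ∘ to-injective f))
      where
      conjugate : LinearNormalizer a b → LinearNormalizer (to f a) (to f b) →
        Extendable 2 (∑e 2)
      conjugate (linear-normalizer h h-add ha hb) (linear-normalizer h′ h′-add h′fa h′fb) =
        extend-moved-∑e (h′ ∙ (f ∙ h ⁻¹)) (s≤s (s≤s z≤n)) trans₂
          (∙-closed {h′} {f ∙ h ⁻¹} (linear h′ h′-add)
            (∙-closed {f} {h ⁻¹} Gf (⁻¹-closed {h} (linear h h-add))))
          q-fix λ p → f-moves (to-injective h′ (image p))
        where
        open ≋-Reasoning

        e₀+e₁≋∑ : e 0 +ᴹ e 1 ≋ ∑e 2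
        e₀+e₁≋∑ = pointwise λ { 0 → refl ; 1 → refl ; (suc (suc _)) → refl }

        ∑-image : ∀ g {u v} → Additive g → to g u ≋ e 0 → to g v ≋ e 1 →
                  to g (u +ᴹ v) ≋ ∑e 2
        ∑-image g g-add gu gv = ≋-trans (g-add _ _) (≋-trans (+ᴹ-cong gu gv) e₀+e₁≋∑)

        q-fix : Fixes (h′ ∙ (f ∙ h ⁻¹)) 2
        q-fix {0} _ = ≋-trans (to-cong h′ (to-cong f (to⇒from h ha))) h′fa
        q-fix {1} _ = ≋-trans (to-cong h′ (to-cong f (to⇒from h hb))) h′fb
        q-fix {suc (suc _)} (s≤s (s≤s ()))

        image : to h′ (to f (from h (∑e 2))) ≋ ∑e 2 →
                to h′ (to f (a +ᴹ b)) ≋ to h′ (to f a +ᴹ to f b)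
        image p = begin
          to h′ (to f (a +ᴹ b))
            ≈⟨ to-cong h′ (to-cong f (to⇒from h (∑-image h h-add ha hb))) ⟨
          to h′ (to f (from h (∑e 2)))  ≈⟨ p ⟩
          ∑e 2                          ≈⟨ ∑-image h′ h′-add h′fa h′fb ⟨
          to h′ (to f a +ᴹ to f b)      ∎

    additive : Additive f
    additive a b = by-cases (to f (a +ᴹ b) ≋? (to f a +ᴹ to f b)) (a ≋? 0ᴹ) (b ≋? 0ᴹ) (a ≋? b)
      where
      open ≋-Reasoning
      by-cases : Dec (to f (a +ᴹ b) ≋ to f a +ᴹ to f b) →
        Dec (a ≋ 0ᴹ) → Dec (b ≋ 0ᴹ) → Dec (a ≋ b) → to f (a +ᴹ b) ≋ to f a +ᴹ to f b
      by-cases (yes p) _ _ _ = p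
      by-cases (no ¬p) (no a≉0) (no b≉0) (no a≉b) =
        contradiction (generic a b a≉0 b≉0 a≉b ¬p) ¬ext
      -- The degenerate pairs satisfy the equation because `f` fixes 0.
      by-cases (no _) (yes a≋0) _ _ = begin
        to f (a +ᴹ b)       ≈⟨ to-cong f (+ᴹ-cong a≋0 (≋-refl {b})) ⟩
        to f (0ᴹ +ᴹ b)      ≈⟨ to-cong f (pointwise λ _ → refl) ⟩
        to f b              ≈⟨ pointwise (λ _ → refl) ⟩
        0ᴹ +ᴹ to f b        ≈⟨ +ᴹ-cong f0 (≋-refl {to f b}) ⟨
        to f 0ᴹ +ᴹ to f b   ≈⟨ +ᴹ-cong (to-cong f a≋0) (≋-refl {to f b}) ⟨
        to f a +ᴹ to f b    ∎
      by-cases (no _) (no _) (yes b≋0) _ = begin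
        to f (a +ᴹ b)       ≈⟨ to-cong f (+ᴹ-cong (≋-refl {a}) b≋0) ⟩
        to f (a +ᴹ 0ᴹ)      ≈⟨ to-cong f (+ᴹ-identityʳ a) ⟩
        to f a              ≈⟨ +ᴹ-identityʳ (to f a) ⟨
        to f a +ᴹ 0ᴹ        ≈⟨ +ᴹ-cong (≋-refl {to f a}) f0 ⟨
        to f a +ᴹ to f 0ᴹ   ≈⟨ +ᴹ-cong (≋-refl {to f a}) (to-cong f b≋0) ⟨
        to f a +ᴹ to f b    ∎
      by-cases (no _) (no _) (no _) (yes a≋b) = begin
        to f (a +ᴹ b)       ≈⟨ to-cong f (+ᴹ-cong a≋b (≋-refl {b})) ⟩
        to f (b +ᴹ b)       ≈⟨ to-cong f (+ᴹ-self b) ⟩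
        to f 0ᴹ             ≈⟨ f0 ⟩
        0ᴹ                  ≈⟨ +ᴹ-self (to f b) ⟨
        to f b +ᴹ to f b    ≈⟨ +ᴹ-cong (to-cong f a≋b) (≋-refl {to f b}) ⟨
        to f a +ᴹ to f b    ∎

  -- r maps the circuit (e₀ , … , eₙ₋₁ , e₀ + … + eₙ₋₁) onto (e₀ , … , eₙ). Some
  -- linear h permuting the circuit moves c = r⁻¹(e₀ + … + eₙ), because no vector
  -- outside the circuit and 0 is invariant under all such h; undoing the
  -- permutation by σ, the conjugate σ r h r⁻¹ fixes e₀ , … , eₙ and moves their sum.
  circuit-extends : 2 ≤ n → Transitive (suc n) → Extendable (suc n) (∑e (suc n))
  circuit-extends {n} 2≤n trans-k = by-normalizer (trans-k (update e n (∑e n))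
    (update-e-distinct (∑e≉0 (<⇒≤ 2≤n)) (λ _ _ p → ∑e≉e 2≤n (≋-sym p))))
    where
    2≤1+n : 2 ≤ suc n
    2≤1+n = m≤n⇒m≤1+n 2≤n

    by-normalizer : Normalizer (suc n) (update e n (∑e n)) → Extendable (suc n) (∑e (suc n))
    by-normalizer (normalizer r Gr r-eq) = by-support (supported? n c)
      where
      c = from r (∑e (suc n))

      r-c : to r c ≋ ∑e (suc n)
      r-c = to-from r (∑e (suc n))

      r-e : j < n → to r (e j) ≋ e j
      r-e j<n = ≋-trans (to-cong r (≋-reflexive (sym (update-off e (<⇒≢ j<n)))))
                        (r-eq (m<n⇒m<1+n j<n))

      r-∑ : to r (∑e n) ≋ e n
      r-∑ = ≋-trans (to-cong r (≋-reflexive (sym (update-at e n (∑e n))))) (r-eq ≤-refl)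

      c≉0 : ¬ c ≋ 0ᴹ
      c≉0 p = ∑e≉0 (<⇒≤ 2≤1+n) (≋-trans (≋-sym r-c) (≋-trans (to-cong r p) (g0≋0 r Gr)))

      c≉∑ : ¬ c ≋ ∑e n
      c≉∑ p = ∑e≉e 2≤1+n (≋-trans (≋-sym r-c) (≋-trans (to-cong r p) r-∑))

      -- The part common to both choices of `h`. Since `r` sends `c` to the sum of e₀ , ... , eₙ and
      -- `σ` fixes that sum, the conjugate moves the sum because `h` moves `c`.
      conjugate-extends : ∀ σ h → Additive σ → Additive h →
        (∀ {j} → j < n → to σ (to r (to h (e j))) ≋ e j) →
        to h (∑e n) ≋ ∑e n → to σ (e n) ≋ e n → to σ (∑e (suc n)) ≋ ∑e (suc n) →
        ¬ to h c ≋ c → Extendable (suc n) (∑e (suc n))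
      conjugate-extends σ h σ-add h-add q-e h-∑ σ-n σ-∑ h-moves =
        extend-moved-∑e (σ ∙ (r ∙ (h ∙ r ⁻¹))) 2≤1+n trans-k
          (∙-closed {σ} {r ∙ (h ∙ r ⁻¹)} (linear σ σ-add)
            (∙-closed {r} {h ∙ r ⁻¹} Gr
              (∙-closed {h} {r ⁻¹} (linear h h-add) (⁻¹-closed {r} Gr))))
          (λ j<1+n → q-fix (m<1+n⇒m<n∨m≡n j<1+n))
          λ p → h-moves (to-injective r
            (≋-trans (to-injective σ (≋-trans p (≋-sym σ-∑))) (≋-sym r-c)))
        where
        open ≋-Reasoning
        q-fix : j < n ⊎ j ≡ n → to σ (to r (to h (from r (e j)))) ≋ e j
        q-fix {j} (inj₁ j<n) = begin
          to σ (to r (to h (from r (e j))))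
            ≈⟨ to-cong σ (to-cong r (to-cong h (to⇒from r (r-e j<n)))) ⟩
          to σ (to r (to h (e j)))  ≈⟨ q-e j<n ⟩
          e j                       ∎
        q-fix (inj₂ refl) = begin
          to σ (to r (to h (from r (e n))))
            ≈⟨ to-cong σ (to-cong r (to-cong h (to⇒from r r-∑))) ⟩
          to σ (to r (to h (∑e n)))  ≈⟨ to-cong σ (to-cong r h-∑) ⟩
          to σ (to r (∑e n))         ≈⟨ to-cong σ r-∑ ⟩
          to σ (e n)                 ≈⟨ σ-n ⟩
          e n                        ∎

      -- With `N` past the support of `c`, exchanging `c` and `e N` moves `c`. The circuit vectors
      -- vanish at `N` and `m`, so they stay fixed and there is no permutation to undo.
      by-exchange : n ≤ m → Exchange (bound c ⊔ n) m c → Extendable (suc n) (∑e (suc n))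
      by-exchange n≤m (exchanging h h-add _ hc h-fix) =
        conjugate-extends ε h (λ _ _ → ≋-refl) h-add
          (λ j<n → ≋-trans (to-cong r (h-fix (e-off (>⇒≢ (<-≤-trans j<n n≤N)))
                                             (e-off (>⇒≢ (<-≤-trans j<n n≤m)))))
                           (r-e j<n))
          (h-fix (∑e-outside n≤N) (∑e-outside n≤m)) ≋-refl ≋-refl
          λ hc≋c → differ-at N (e-diag N) (vanishing c N (m≤m⊔n (bound c) n))
                     (≋-trans (≋-sym hc) hc≋c)
        where
        N = bound c ⊔ n
        n≤N : n ≤ N
        n≤N = m≤n⊔m (bound c) n

      -- Swapping a zero coordinate of `c` with a nonzero one moves `c`. On the circuit this only
      -- interchanges eᵢ and eₘ, which `r` fixes, so the same swap applied after `r` undoes it.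
      by-swap : i < n → m < n → coeff c i ≡ false → coeff c m ≡ true → Swap i m →
        Extendable (suc n) (∑e (suc n))
      by-swap {i} {m} i<n m<n cᵢ cₘ (swapping h h-add h-eᵢ h-eₘ h-fix h-moves) =
        conjugate-extends h h h-add h-add q-e
          (h-fix (trans (∑e-inside i<n) (sym (∑e-inside m<n))))
          (h-fix (trans (e-off (<⇒≢ i<n)) (sym (e-off (<⇒≢ m<n)))))
          (h-fix (trans (∑e-inside (m<n⇒m<1+n i<n)) (sym (∑e-inside (m<n⇒m<1+n m<n)))))
          (h-moves {c} cᵢ cₘ)
        where
        q-e : j < n → to h (to r (to h (e j))) ≋ e j
        q-e {j} j<n with j ≟ i | j ≟ m
        ... | yes refl | _ =
          ≋-trans (to-cong h (≋-trans (to-cong r h-eᵢ) (r-e m<n))) h-eₘ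
        ... | no _ | yes refl =
          ≋-trans (to-cong h (≋-trans (to-cong r h-eₘ) (r-e i<n))) h-eᵢ
        ... | no j≢i | no j≢m =
          ≋-trans (to-cong h (≋-trans (to-cong r h-eⱼ) (r-e j<n))) h-eⱼ
          where
          h-eⱼ : to h (e j) ≋ e j
          h-eⱼ = h-fix (trans (e-off (j≢i ∘ sym)) (sym (e-off (j≢m ∘ sym))))

      by-gap : Supported n c → (∃[ m ] coeff c m ≡ true) →
        c ≋ ∑e n ⊎ (∃[ i ] i < n × coeff c i ≡ false) → Extendable (suc n) (∑e (suc n))
      by-gap s _        (inj₁ c≋∑)            = contradiction c≋∑ c≉∑
      by-gap s (m , cₘ) (inj₂ (i , i<n , cᵢ)) =
        by-swap i<n (≰⇒> λ n≤m → true≢false (trans (sym cₘ) (s m n≤m))) cᵢ cₘ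
          (swap i m λ { refl → true≢false (trans (sym cₘ) cᵢ) })

      by-support : Supported n c ⊎ (∃[ m ] n ≤ m × coeff c m ≡ true) →
        Extendable (suc n) (∑e (suc n))
      by-support (inj₁ s)              = by-gap s (nonzero-coeff c≉0) (∑e-or-gap n c s)
      by-support (inj₂ (m , n≤m , cₘ)) = by-exchange n≤m (exchange (bound c ⊔ n) c m cₘ)

  -- High transitivity and interpolation on finite sets.

  module HighlyTransitive (∑e₂-extends : Transitive 2 → Extendable 2 (∑e 2)) where

    -- For k = 0 the sum is 0 and for k = 1 it is e₀, both excluded. The case k = 2 depends on a
    -- nonlinear element of `G` and is therefore a parameter of the module.
    ∑e-extends : ∀ k → Transitive k → ¬ ∑e k ≋ 0ᴹ → (∀ {j} → j < k → ¬ e j ≋ ∑e k) →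
      Extendable k (∑e k)
    ∑e-extends 0 _ ∑≉0 _ = contradiction (pointwise λ _ → refl) ∑≉0
    ∑e-extends 1 _ _ e≉∑ =
      contradiction (pointwise λ { zero → refl ; (suc _) → refl }) (e≉∑ z<s)
    ∑e-extends 2 trans₂ _ _ = ∑e₂-extends trans₂
    ∑e-extends (suc (suc (suc _))) trans-k _ _ = circuit-extends (s≤s (s≤s z≤n)) trans-k

    extends : Transitive k → ¬ y ≋ 0ᴹ → (∀ {j} → j < k → ¬ e j ≋ y) → Extendable k y
    extends {k} {y} trans-k y≉0 y≉e with y ≋? ∑e k
    ... | no  y≉∑ = extend-≉∑e trans-k y≉0 y≉e y≉∑
    ... | yes y≋∑ = transport ε ε-closed (λ _ → ≋-refl) y≋∑
            (∑e-extends k trans-k (y≉0 ∘ ≋-trans y≋∑)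
              (λ j<k p → y≉e j<k (≋-trans p (≋-sym y≋∑))))

    transitive : ∀ k → Transitive k
    transitive zero    a _ = normalizer ε ε-closed λ ()
    transitive (suc k) a d = by-normalizer (transitive k a record
      { nonzero   = λ j<k → nonzero d (m<n⇒m<1+n j<k)
      ; injective = λ i<k j<k → injective d (m<n⇒m<1+n i<k) (m<n⇒m<1+n j<k)
      })
      where
      by-normalizer : Normalizer k a → Normalizer (suc k) a
      by-normalizer (normalizer g Gg g-a) = by-extension
        (extends (transitive k) (g≉0 g Gg (nonzero d ≤-refl))
          (λ j<k p → <⇒≢ j<k (injective d (m<n⇒m<1+n j<k) ≤-refl
            (to-injective g (≋-trans (g-a j<k) p)))))
        where
        by-extension : Extendable k (to g (a k)) → Normalizer (suc k) a
        by-extension (extension h Gh h-fix h-y) =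
          normalizer (h ∙ g) (∙-closed {h} {g} Gh Gg) λ j<1+k → images (m<1+n⇒m<n∨m≡n j<1+k)
          where
          images : j < k ⊎ j ≡ k → to h (to g (a j)) ≋ e j
          images (inj₁ j<k)  = ≋-trans (to-cong h (g-a j<k)) (h-fix j<k)
          images (inj₂ refl) = h-y

    -- If `g` normalizes the nonzero vectors of `S` and `h` normalizes their images under `π`, then
    -- `g` followed by the inverse of `h` agrees with `π` on them; at 0 both sides are 0.
    interpolate : ∀ π → Sym[𝔽₂^ω]₀ π → ∀ S →
      Σ[ σ ∈ Perm ] (G σ × All (λ x → ∀ i → coeff (to σ x) i ≡ coeff (to π x) i) S)
    interpolate π π0 S = by-enumeration (enumerate S)
      where
      π0≋0 : to π 0ᴹ ≋ 0ᴹ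
      π0≋0 = pointwise π0

      by-enumeration : Enumeration S →
        Σ[ σ ∈ Perm ] (G σ × All (λ x → ∀ i → coeff (to σ x) i ≡ coeff (to π x) i) S)
      by-enumeration (enumeration {k} {a} d cover) =
        by-normalizers (transitive k a d) (transitive k (to π ∘ a) (perm-distinct π π0≋0 d))
        where
        by-normalizers : Normalizer k a → Normalizer k (to π ∘ a) →
          Σ[ σ ∈ Perm ] (G σ × All (λ x → ∀ i → coeff (to σ x) i ≡ coeff (to π x) i) S)
        by-normalizers (normalizer g Gg g-a) (normalizer h Gh h-a) =
          h ⁻¹ ∙ g , σ∈G , All.map (λ {x} c → at (agree {x} c)) cover
          where
          open ≋-Reasoning

          σ∈G : G (h ⁻¹ ∙ g)
          σ∈G = ∙-closed {h ⁻¹} {g} (⁻¹-closed {h} Gh) Gg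

          agree : x ≋ 0ᴹ ⊎ (∃[ j ] j < k × x ≋ a j) → from h (to g x) ≋ to π x
          agree {x} (inj₁ x≋0) = begin
            from h (to g x)   ≈⟨ to-cong (h ⁻¹ ∙ g) x≋0 ⟩
            from h (to g 0ᴹ)  ≈⟨ g0≋0 (h ⁻¹ ∙ g) σ∈G ⟩
            0ᴹ                ≈⟨ π0≋0 ⟨
            to π 0ᴹ           ≈⟨ to-cong π x≋0 ⟨
            to π x            ∎
          agree {x} (inj₂ (j , j<k , x≋aⱼ)) = begin
            from h (to g x)      ≈⟨ to-cong (h ⁻¹ ∙ g) x≋aⱼ ⟩
            from h (to g (a j))  ≈⟨ to-cong (h ⁻¹) (g-a j<k) ⟩
            from h (e j)         ≈⟨ to⇒from h (h-a j<k) ⟩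
            to π (a j)           ≈⟨ to-cong π x≋aⱼ ⟨
            to π x               ∎

theorem2p3 : ∀ {ℓ} → ExcludedMiddle ℓ →
    (G : Pred (Group.Carrier Sym[𝔽₂^ω]) ℓ) →
    IsSubgroup Sym[𝔽₂^ω] G →
    IsClosed V G →
    GL[ω,2] ⊂ G →
    G ⊆ Sym[𝔽₂^ω]₀ →
    G ≐ Sym[𝔽₂^ω]₀
theorem2p3 em G G-subgroup G-closed (GL⊆G , G⊈GL) G⊆Sym₀ =
  G⊆Sym₀ , λ {π} π0 → G-closed π (interpolate π π0)
  where
  open Overgroup G G-subgroup GL⊆G G⊆Sym₀

  ∑e₂-extends : Transitive 2 → Extendable 2 (∑e 2)
  -- Were the sum not extendable, every element of `G` would be additive, hence linear, against
  -- properness of the inclusion. Excluded middle turns this refutation into an actual extension.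
  ∑e₂-extends trans₂ with em {Extendable 2 (∑e 2)}
  ... | yes ext = ext
  ... | no ¬ext = contradiction
    (λ {f} Gf → additive⇒GL f λ a b → additive-if-not-extendable f Gf trans₂ ¬ext a b) G⊈GL

  open HighlyTransitive ∑e₂-extends
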